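{- Let $\mathcal{H}$ be a pseudohalfplane hypergraph on a finite totally ordered vertex set $V$ with $|V|=n\ge 2$. If every pair of vertices of $V$ is contained in some hyperedge $H\in\mathcal{H}$, then there exist at most $3$ hyperedges of $\mathcal{H}$ whose union is $V$.
   Context: A hypergraph $\mathcal{F}$ on a totally ordered finite vertex set $V$ (a family of subsets of $V$) is ABA-free if there are no two hyperedges $A,B\in\mathcal{F}$ and vertices $x<y<z$ with $x,z\in A\setminus B$ and $y\in B\setminus A$. For a family $\mathcal{F}$ of subsets of $V$ let $\bar{\mathcal{F}}=\{V\setminus F: F\in\mathcal{F}\}$. A hypergraph $\mathcal{H}$ on $V$ is a pseudohalfplane hypergraph if there exists an ABA-free hypergraph $\mathcal{F}$ on $V$ such that $\mathcal{H}\subseteq\mathcal{F}\cup\bar{\mathcal{F}}$. -}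

module Defs where

open import Data.Nat using (ℕ)
open import Data.Fin using (Fin; _<_)
open import Data.Fin.Subset using (Subset; _∈_; _∉_; ∁)
open import Data.List using (List)
open import Data.List.Membership.Propositional using () renaming (_∈_ to _∈ₗ_)
open import Data.Product using (Σ; ∃; _×_; _,_)
open import Data.Sum using (_⊎_)
open import Relation.Binary.PropositionalEquality using (_≡_)
open import Relation.Nullary using (¬_)

-- Vertex set V = Fin n with its natural total order; subsets of V are
-- `Subset n`; a hypergraph (family of subsets) is a finite list of subsets.
Hypergraph : ℕ → Set
Hypergraph n = List (Subset n)

ABA : {n : ℕ} → Subset n → Subset n → Set
ABA {n} A B = Σ (Fin n) λ x → Σ (Fin n) λ y → Σ (Fin n) λ z →
  x < y × y < z ×
  (x ∈ A × x ∉ B) × (z ∈ A × z ∉ B) × (y ∈ B × y ∉ A)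

ABA-free : {n : ℕ} → Hypergraph n → Set
ABA-free ℱ = ∀ A B → A ∈ₗ ℱ → B ∈ₗ ℱ → ¬ ABA A B

_∈∪compl_ : {n : ℕ} → Subset n → Hypergraph n → Set
H ∈∪compl ℱ = H ∈ₗ ℱ ⊎ Σ (Subset _) λ F → F ∈ₗ ℱ × H ≡ ∁ F

PseudohalfplaneHypergraph : {n : ℕ} → Hypergraph n → Set
PseudohalfplaneHypergraph {n} ℋ =
  Σ (Hypergraph n) λ ℱ → ABA-free ℱ × (∀ H → H ∈ₗ ℋ → H ∈∪compl ℱ)

{-# OPTIONS --safe #-}
-- Pass to the complements C = V ∖ H of the hyperedges.  If no three hyperedges cover V, then any
-- three complements share a vertex, while every pair of vertices is missed by some complement.
-- Call a complement upper if it lies in ℱ and lower if it is the complement of a member of ℱ.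
--
-- There is a gap between two consecutive vertices that behaves like the abscissa of a virtual
-- point lying in all the complements, and that every complement straddles.  Straddling gives a
-- pair of vertices, one on each side of the gap, missed by a lower complement.  In an innermost
-- such pair x < z nothing lies between x and z: otherwise let t be the neighbour of z on the upper
-- hull of the vertices in (x, z].  By minimality the pair formed by t and the one of x, z
-- across the gap is missed by an upper complement, and the three complements missing the
-- sides of the triangle x t z have no common vertex.  By duality the two vertices next to the gap
-- are missed both by a lower and by an upper complement, which is impossible.
module Submission where

open import Defs
open import Data.Nat using (ℕ; _≤_; z≤n; s≤s)
import Data.Nat.Properties as ℕ
open import Data.Empty using (⊥; ⊥-elim)
open import Data.Fin using (Fin; zero; suc; toℕ; _<_; _>_) renaming (_≤_ to _≤ᶠ_)
open import Data.Fin.Induction using (<-wellFounded; >-wellFounded)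
open import Data.Fin.Properties using (<-cmp; all?)
open import Data.Fin.Subset using (Subset; _∈_; _∉_; ∁)
open import Data.Fin.Subset.Properties
  using (_∈?_; x∈p⇒x∉∁p; x∈∁p⇒x∉p; x∉∁p⇒x∈p; x∉p⇒x∈∁p)
open import Data.List using (List; []; _∷_; length)
open import Data.List.Membership.Propositional using (find; lose) renaming (_∈_ to _∈ₗ_)
open import Data.List.Relation.Unary.Any using (any?; here; there)
open import Data.Product using (Σ; ∃; _×_; _,_; proj₁; proj₂)
open import Data.Sum using (_⊎_; inj₁; inj₂; swap)
open import Function using (_∘_)
open import Induction.WellFounded using (WellFounded; Acc; acc)
open import Relation.Binary.Definitions using (tri<; tri≈; tri>)
open import Relation.Binary.PropositionalEquality using (_≡_; _≢_; refl; sym; subst)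
open import Relation.Nullary using (¬_; Dec; yes; no; _⊎-dec_)
open import Relation.Unary using (_∪_)

-- `U` and `L` are not assumed decidable, so a minimal element exists only up to double negation,
-- which suffices for goals of type `⊥`.
noMinimal : {A : Set} {_≺_ : A → A → Set} → WellFounded _≺_ → {P : A → Set} →
  (∀ x → P x → (∀ y → y ≺ x → ¬ P y) → ⊥) → ∀ x → ¬ P x
noMinimal {A} {_≺_} wf {P} h x = go x (wf x)
  where
  go : ∀ x → Acc _≺_ x → ¬ P x
  go x (acc rs) px = h x px λ y y≺x → go y (rs y≺x)

noLeast : ∀ {n} {P : Fin n → Set} →
  (∀ x → P x → (∀ y → y < x → ¬ P y) → ⊥) → ∀ x → ¬ P x
noLeast = noMinimal <-wellFounded

noGreatest : ∀ {n} {P : Fin n → Set} →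
  (∀ x → P x → (∀ y → y > x → ¬ P y) → ⊥) → ∀ x → ¬ P x
noGreatest = noMinimal >-wellFounded

∈∉⇒≢ : ∀ {n} {A : Subset n} {x y} → x ∈ A → y ∉ A → x ≢ y
∈∉⇒≢ x∈A y∉A refl = y∉A x∈A

≮∧≢⇒> : ∀ {n} {x y : Fin n} → ¬ x < y → x ≢ y → y < x
≮∧≢⇒> {x = x} {y} x≮y x≢y with <-cmp x y
... | tri< x<y _ _ = ⊥-elim (x≮y x<y)
... | tri≈ _ x≡y _ = ⊥-elim (x≢y x≡y)
... | tri> _ _ y<x = y<x

-- U and L are the upper and the lower complements.  For A upper and B = ∁ F lower we have
-- A ∩ B = A ∖ F and ∁ (A ∪ B) = F ∖ A, so ABA-freeness of {A, F} becomes ∩∅∩-free and ∅∩∅-free.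
record HalfplaneSystem {n : ℕ} (U L : Subset n → Set) : Set where
  field
    U-free : ∀ {A B} → U A → U B → ¬ ABA A B
    L-free : ∀ {A B} → L A → L B → ¬ ABA A B
    ∩∅∩-free : ∀ {A B x y z} → U A → L B → x < y → y < z →
      x ∈ A → x ∈ B → y ∉ A → y ∉ B → z ∈ A → ¬ (z ∈ B)
    ∅∩∅-free : ∀ {A B x y z} → U A → L B → x < y → y < z →
      x ∉ A → x ∉ B → y ∈ A → y ∈ B → z ∉ A → ¬ (z ∉ B)
    triple : ∀ {A B C} → (U ∪ L) A → (U ∪ L) B → (U ∪ L) C →
      ¬ (∀ v → v ∈ A → v ∈ B → ¬ (v ∈ C))
    miss₁ : ∀ x → ∃ λ A → (U ∪ L) A × x ∉ A
    miss₂ : ∀ x y → x ≢ y → ∃ λ A → (U ∪ L) A × x ∉ A × y ∉ A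

dual : ∀ {n} {U L : Subset n → Set} → HalfplaneSystem U L → HalfplaneSystem L U
dual 𝒮 = record
  { U-free   = L-free
  ; L-free   = U-free
  ; ∩∅∩-free = λ a b x<y y<z xA xB yA yB zA zB → ∩∅∩-free b a x<y y<z xB xA yB yA zB zA
  ; ∅∩∅-free = λ a b x<y y<z xA xB yA yB zA zB → ∅∩∅-free b a x<y y<z xB xA yB yA zB zA
  ; triple   = λ a b c → triple (swap a) (swap b) (swap c)
  ; miss₁    = λ x → let (A , a , x∉A) = miss₁ x in A , swap a , x∉A
  ; miss₂    = λ x y x≢y → let (A , a , m) = miss₂ x y x≢y in A , swap a , m
  }
  where open HalfplaneSystem 𝒮

-- The gap lies between k and its successor; left and right say that a virtual vertex placed there
-- and belonging to all members of U and L keeps the system ∩∅∩-free.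
record Gap {n : ℕ} (U L : Subset n → Set) (k : Fin n) : Set where
  field
    left : ∀ {A B x v} → U A → L B → x ≤ᶠ k → x ∉ A → x ∉ B → v ∈ A → v ∈ B → x < v
    right : ∀ {A B x v} → U A → L B → k < x → x ∉ A → x ∉ B → v ∈ A → v ∈ B → v < x
    straddleˡ : ∀ {A} → (U ∪ L) A → ¬ (∀ v → v ∈ A → ¬ (v ≤ᶠ k))
    straddleʳ : ∀ {A} → (U ∪ L) A → ¬ (∀ v → v ∈ A → ¬ (k < v))

dualGap : ∀ {n} {U L : Subset n → Set} {k} → Gap U L k → Gap L U k
dualGap g = record
  { left      = λ a b x≤k xA xB vA vB → left b a x≤k xB xA vB vA
  ; right     = λ a b k<x xA xB vA vB → right b a k<x xB xA vB vA
  ; straddleˡ = λ a → straddleˡ (swap a)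
  ; straddleʳ = λ a → straddleʳ (swap a)
  }
  where open Gap g

-- Existence of the gap

module _ {n : ℕ} {U L : Subset n → Set} (𝒮 : HalfplaneSystem U L) where
  open HalfplaneSystem 𝒮

  -- By `∩∅∩-free`, `A ∩ B` lies before `x` and `A′ ∩ B′` after `k`. Common vertices of the four
  -- triples among these sets then give a forbidden pattern, or a vertex on both sides.
  directions-monotone : ∀ {A B A′ B′ x k v v′} → U A → L B → U A′ → L B′ → x ≤ᶠ k →
    x ∉ A → x ∉ B → v ∈ A → v ∈ B → v < x →
    k ∉ A′ → k ∉ B′ → v′ ∈ A′ → v′ ∈ B′ → k < v′ → ⊥
  directions-monotone {A} {B} {A′} {B′} {x} {k} a b a′ b′ x≤k x∉A x∉B v∈A v∈B v<x
    k∉A′ k∉B′ v′∈A′ v′∈B′ k<v′ =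
    triple (inj₁ a) (inj₂ b) (inj₂ b′) λ q q∈A q∈B q∈B′ →
    triple (inj₁ a) (inj₁ a′) (inj₂ b′) λ r r∈A r∈A′ r∈B′ →
    triple (inj₁ a) (inj₂ b) (inj₁ a′) λ p p∈A p∈B p∈A′ →
    triple (inj₁ a′) (inj₂ b′) (inj₂ b) λ t t∈A′ t∈B′ t∈B →
    conclude (before q∈A q∈B) q∈A q∈B q∈B′ (after r∈A′ r∈B′) r∈A r∈B′
             (before p∈A p∈B) p∈A′ p∈B (after t∈A′ t∈B′) t∈A′ t∈B
    where
    before : ∀ {w} → w ∈ A → w ∈ B → w < x
    before w∈A w∈B = ≮∧≢⇒>
      (λ x<w → ∩∅∩-free a b v<x x<w v∈A v∈B x∉A x∉B w∈A w∈B) (∈∉⇒≢ w∈A x∉A ∘ sym)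

    after : ∀ {w} → w ∈ A′ → w ∈ B′ → k < w
    after w∈A′ w∈B′ = ≮∧≢⇒>
      (λ w<k → ∩∅∩-free a′ b′ w<k k<v′ w∈A′ w∈B′ k∉A′ k∉B′ v′∈A′ v′∈B′) (∈∉⇒≢ w∈A′ k∉A′)

    conclude : ∀ {p q r t} → q < x → q ∈ A → q ∈ B → q ∈ B′ → k < r → r ∈ A → r ∈ B′ →
      p < x → p ∈ A′ → p ∈ B → k < t → t ∈ A′ → t ∈ B → ⊥
    conclude {q = q} q<x q∈A q∈B q∈B′ k<r r∈A r∈B′ p<x p∈A′ p∈B k<t t∈A′ t∈B
      with k ∈? A | x ∈? A′ | q ∈? A′
    ... | no k∉A | _ | _ =
      ∩∅∩-free a b′ (ℕ.<-≤-trans q<x x≤k) k<r q∈A q∈B′ k∉A k∉B′ r∈A r∈B′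
    ... | yes _ | no x∉A′ | _ =
      ∩∅∩-free a′ b p<x (ℕ.≤-<-trans x≤k k<t) p∈A′ p∈B x∉A′ x∉B t∈A′ t∈B
    ... | yes _ | yes _ | yes q∈A′ =
      ℕ.<-asym (ℕ.<-≤-trans q<x x≤k) (after q∈A′ q∈B′)
    ... | yes k∈A | yes x∈A′ | no q∉A′ =
      U-free a a′ (q , x , k , q<x , x<k , (q∈A , q∉A′) , (k∈A , k∉A′) , (x∈A′ , x∉A))
      where
      x<k : x < k
      x<k = ≮∧≢⇒> (ℕ.≤⇒≯ x≤k) (∈∉⇒≢ k∈A x∉A)

  -- A virtual vertex common to all sets must come after `x`: either some set needs a member before
  -- it, or `A ∩ B` lies entirely beyond `x`.
  ForcedLeft : Fin n → Set
  ForcedLeft x =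
    (∃ λ A → (U ∪ L) A × (∀ v → v ∈ A → x ≤ᶠ v)) ⊎
    (∃ λ A → ∃ λ B → ∃ λ v → U A × L B × x ∉ A × x ∉ B × v ∈ A × v ∈ B × x < v)

  -- Maximality of `k` gives `right` and `straddleˡ`; the reason why `k` itself is forced gives
  -- `left` and `straddleʳ`.
  greatest-ForcedLeft⇒Gap : ∀ k → ForcedLeft k → (∀ y → y > k → ¬ ForcedLeft y) → Gap U L k
  greatest-ForcedLeft⇒Gap k forced greatest = record
    { left = left ; right = right ; straddleˡ = straddleˡ ; straddleʳ = straddleʳ forced }
    where
    not-before : ForcedLeft k → ∀ {A B x v} → U A → L B → x ≤ᶠ k → x ∉ A → x ∉ B →
      v ∈ A → v ∈ B → ¬ (v < x)
    not-before (inj₁ (C , c , k≤C)) {x = x} a b x≤k x∉A x∉B v∈A v∈B v<x =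
      triple (inj₁ a) (inj₂ b) c λ w w∈A w∈B w∈C →
      ∩∅∩-free a b v<x
        (≮∧≢⇒> (ℕ.≤⇒≯ (ℕ.≤-trans x≤k (k≤C w w∈C))) (∈∉⇒≢ w∈A x∉A))
        v∈A v∈B x∉A x∉B w∈A w∈B
    not-before (inj₂ (A′ , B′ , v′ , a′ , b′ , k∉A′ , k∉B′ , v′∈A′ , v′∈B′ , k<v′))
      a b x≤k x∉A x∉B v∈A v∈B v<x =
      directions-monotone a b a′ b′ x≤k x∉A x∉B v∈A v∈B v<x k∉A′ k∉B′ v′∈A′ v′∈B′ k<v′

    left : ∀ {A B x v} → U A → L B → x ≤ᶠ k → x ∉ A → x ∉ B → v ∈ A → v ∈ B → x < v
    left a b x≤k x∉A x∉B v∈A v∈B =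
      ≮∧≢⇒> (not-before forced a b x≤k x∉A x∉B v∈A v∈B) (∈∉⇒≢ v∈A x∉A)

    right : ∀ {A B x v} → U A → L B → k < x → x ∉ A → x ∉ B → v ∈ A → v ∈ B → v < x
    right {A} {B} {x} {v} a b k<x x∉A x∉B v∈A v∈B =
      ≮∧≢⇒> (λ x<v → greatest x k<x
              (inj₂ (A , B , v , a , b , x∉A , x∉B , v∈A , v∈B , x<v)))
            (∈∉⇒≢ v∈A x∉A ∘ sym)

    straddleˡ : ∀ {A} → (U ∪ L) A → ¬ (∀ v → v ∈ A → ¬ (v ≤ᶠ k))
    straddleˡ {A} a A≰k = triple a a a λ v v∈A _ _ →
      noLeast {P = _∈ A}
        (λ m m∈A least → greatest m (ℕ.≰⇒> (A≰k m m∈A))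
          (inj₁ (A , a , λ w w∈A → ℕ.≮⇒≥ λ w<m → least w w<m w∈A)))
        v v∈A

    straddleʳ : ForcedLeft k → ∀ {A} → (U ∪ L) A → ¬ (∀ v → v ∈ A → ¬ (k < v))
    straddleʳ (inj₁ (C , c , k≤C)) a A≯k =
      -- `D` keeps the common vertex of `A` and `C` away from `k` itself.
      let (D , d , k∉D) = miss₁ k in
      triple a c d λ v v∈A v∈C v∈D →
      A≯k v v∈A (≮∧≢⇒> (ℕ.≤⇒≯ (k≤C v v∈C)) (∈∉⇒≢ v∈D k∉D))
    straddleʳ (inj₂ (A′ , B′ , v′ , a′ , b′ , k∉A′ , k∉B′ , v′∈A′ , v′∈B′ , k<v′)) a A≯k =
      triple a (inj₁ a′) (inj₂ b′) λ v v∈A v∈A′ v∈B′ →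
      A≯k v v∈A (≮∧≢⇒>
        (λ v<k → ∩∅∩-free a′ b′ v<k k<v′ v∈A′ v∈B′ k∉A′ k∉B′ v′∈A′ v′∈B′)
        (∈∉⇒≢ v∈A′ k∉A′))

  gap-exists : Fin n → ¬ (∀ k → ¬ Gap U L k)
  gap-exists v₀ no-gap =
    let (A , a , _) = miss₁ v₀ in
    triple a a a λ v v∈A _ _ →
    noLeast {P = _∈ A}
      (λ m m∈A least → noGreatest {P = ForcedLeft}
        (λ k forced greatest → no-gap k (greatest-ForcedLeft⇒Gap k forced greatest))
        m (inj₁ (A , a , λ w w∈A → ℕ.≮⇒≥ λ w<m → least w w<m w∈A)))
      v v∈A

-- Pairs across the gap

module _ {n : ℕ} {U L : Subset n → Set} (𝒮 : HalfplaneSystem U L)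
         {k : Fin n} (g : Gap U L k) where
  open HalfplaneSystem 𝒮
  open Gap g

  -- `left` and `right` squeeze a common vertex of `A` and `B` between `x` and `z`, against
  -- `∅∩∅-free`.
  not-both-miss : ∀ {A B x z} → U A → L B → x ≤ᶠ k → k < z →
    x ∉ A → z ∉ A → x ∉ B → ¬ (z ∉ B)
  not-both-miss a b x≤k k<z x∉A z∉A x∉B z∉B =
    triple (inj₁ a) (inj₁ a) (inj₂ b) λ v v∈A _ v∈B →
    ∅∩∅-free a b (left a b x≤k x∉A x∉B v∈A v∈B) (right a b k<z z∉A z∉B v∈A v∈B)
      x∉A x∉B v∈A v∈B z∉A z∉B

  -- The pair x, z is missed by a lower set: the virtual point is below the segment xz.
  BelowPair : Fin n → Fin n → Set
  BelowPair x z = ∃ λ B → L B × x ≤ᶠ k × k < z × x ∉ B × z ∉ B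

  LastBeforeGap : Fin n → Set
  LastBeforeGap a = ∃ λ A → U A × a ∈ A × a ≤ᶠ k × (∀ v → v ∈ A → v ≤ᶠ k → v ≤ᶠ a)

  lastBeforeGap-exists : ∀ {A} → U A →
    ¬ (∀ a → a ∈ A → a ≤ᶠ k → (∀ v → v ∈ A → v ≤ᶠ k → v ≤ᶠ a) → ⊥)
  lastBeforeGap-exists {A} u c = straddleˡ (inj₁ u) λ v v∈A v≤k →
    noGreatest {P = λ a → a ∈ A × a ≤ᶠ k}
      (λ a (a∈A , a≤k) greatest → c a a∈A a≤k λ w w∈A w≤k →
        ℕ.≮⇒≥ λ a<w → greatest w a<w (w∈A , w≤k))
      v (v∈A , v≤k)

  -- Some `z` lies beyond the gap. A set missing `k` and `z` either is lower and gives the pair, or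
  -- is upper, and then an extremal upper set leads to one.
  belowPair-exists : ¬ (∀ x z → ¬ BelowPair x z)
  belowPair-exists none =
    let (C , c , _) = miss₁ k in
    straddleʳ c λ z _ k<z →
    let (A , a , k∉A , z∉A) = miss₂ k z (λ { refl → ℕ.n≮n _ k<z }) in
    U-inhabited a k<z k∉A z∉A
    where
    missed : ∀ {A D a b} → U A → a ∈ A → a ≤ᶠ k → (∀ v → v ∈ A → v ≤ᶠ k → v ≤ᶠ a) →
      (∀ y → y < a → ¬ LastBeforeGap y) → b ∈ A → k < b → (U ∪ L) D → a ∉ D → ¬ (b ∉ D)
    missed {a = a} {b} _ _ a≤k _ _ _ k<b (inj₂ d) a∉D b∉D =
      none a b (_ , d , a≤k , k<b , a∉D , b∉D)
    missed {A} {D} {a} {b} u a∈A a≤k last least b∈A k<b (inj₁ d) a∉D b∉D =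
      -- The last vertex `c` of `D` before the gap is past `a`, hence outside `A`, so `a < c < b` is
      -- an ABA pattern.
      lastBeforeGap-exists d λ c c∈D c≤k lastD →
      let a<c = ≮∧≢⇒> (λ c<a → least c c<a (D , d , c∈D , c≤k , lastD)) (∈∉⇒≢ c∈D a∉D)
      in U-free u d (a , c , b , a<c , ℕ.≤-<-trans c≤k k<b , (a∈A , a∉D) , (b∈A , b∉D) ,
           (c∈D , λ c∈A → ℕ.<⇒≱ a<c (last c c∈A c≤k)))

    -- Among the members A of U choose one whose last vertex before the gap is as far left as
    -- possible; no member of U misses both that vertex and a vertex of A beyond the gap.
    no-lastBeforeGap : ∀ a → ¬ LastBeforeGap a
    no-lastBeforeGap = noLeast λ where
      a (A , u , a∈A , a≤k , last) least → straddleʳ (inj₁ u) λ b b∈A k<b →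
        let a<b = ℕ.≤-<-trans a≤k k<b
            (D , d , a∉D , b∉D) = miss₂ a b (λ { refl → ℕ.n≮n _ a<b })
        in missed u a∈A a≤k last least b∈A k<b d a∉D b∉D

    U-inhabited : ∀ {A z} → (U ∪ L) A → k < z → k ∉ A → ¬ (z ∉ A)
    U-inhabited {z = z} (inj₂ b) k<z k∉B z∉B = none k z (_ , b , ℕ.≤-refl , k<z , k∉B , z∉B)
    U-inhabited (inj₁ u) _ _ _ = lastBeforeGap-exists u λ a a∈A a≤k last →
      no-lastBeforeGap a (_ , u , a∈A , a≤k , last)

  -- Innermost pairs and the upper hull

  Between : Fin n → Fin n → Fin n → Set
  Between x z t = x < t × t < z

  -- Supporting z t and Unskipped x z t together say that t is the neighbour of z on the upper hull
  -- of the vertices in (x, z].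
  Supporting : Fin n → Fin n → Set
  Supporting z t = ∀ {A v} → U A → t < v → v < z → v ∈ A → t ∉ A → ¬ (z ∉ A)

  Unskipped : Fin n → Fin n → Fin n → Set
  Unskipped x z t = ∀ {A v} → U A → x < v → v < t → v ∈ A → z ∈ A → ¬ (t ∉ A)

  innermost⇒adjacent : ∀ {x z} → BelowPair x z →
    (∀ t → t < z → ¬ BelowPair x t) → (∀ t → t > x → ¬ BelowPair t z) →
    ∀ t → ¬ Between x z t
  innermost⇒adjacent {x} {z} (B , b , x≤k , k<z , x∉B , z∉B) least greatest =
    -- The last vertex in between is vacuously supporting; the first supporting one is also
    -- unskipped.
    noGreatest λ t bt above → noLeast {P = λ t → Between x z t × Supporting z t}
      (λ t (bt , supp) below → hull-neighbour bt supp (unskipped bt supp below))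
      t (bt , λ {_} {v} a t<v v<z v∈A t∉A z∉A → above v t<v (ℕ.<-trans (proj₁ bt) t<v , v<z))
    where
    U-misses-one : ∀ {A} → U A → x ∉ A → z ∈ A
    U-misses-one {A} a x∉A with z ∈? A
    ... | yes z∈A = z∈A
    ... | no z∉A = ⊥-elim (not-both-miss a b x≤k k<z x∉A z∉A x∉B z∉B)

    -- If A skips t, then the last vertex of A in (x, t) is supporting too.
    unskipped : ∀ {t} → Between x z t → Supporting z t →
      (∀ y → y < t → ¬ (Between x z y × Supporting z y)) → Unskipped x z t
    unskipped {t} (x<t , t<z) supp below {A} {v} a x<v v<t v∈A z∈A t∉A =
      noGreatest {P = λ v → v ∈ A × x < v × v < t}
        (λ v (v∈A , x<v , v<t) greatest′ → below v v<t
          ((x<v , ℕ.<-trans v<t t<z) , supporting v v∈A x<v v<t greatest′))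
        v (v∈A , x<v , v<t)
      where
      -- A violating `A′` contradicts `supp` or the choice of `v`, or it contains `t` or `w` outside
      -- `A`, forming an ABA pattern with `v` and `z`.
      supporting : ∀ v → v ∈ A → x < v → v < t →
        (∀ y → y > v → ¬ (y ∈ A × x < y × y < t)) → Supporting z v
      supporting v v∈A x<v v<t greatest′ {A′} {w} a′ v<w w<z w∈A′ v∉A′ z∉A′
        with t ∈? A′ | <-cmp w t | w ∈? A
      ... | yes t∈A′ | _ | _ =
        U-free a a′ (v , t , z , v<t , t<z , (v∈A , v∉A′) , (z∈A , z∉A′) , (t∈A′ , t∉A))
      ... | no t∉A′ | tri≈ _ refl _ | _ = t∉A′ w∈A′
      ... | no t∉A′ | tri> _ _ t<w | _ = supp a′ t<w w<z w∈A′ t∉A′ z∉A′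
      ... | no _ | tri< w<t _ _ | yes w∈A = greatest′ w v<w (w∈A , ℕ.<-trans x<v v<w , w<t)
      ... | no _ | tri< _ _ _ | no w∉A =
        U-free a a′ (v , w , z , v<w , w<z , (v∈A , v∉A′) , (z∈A , z∉A′) , (w∈A′ , w∉A))

    module _ {t : Fin n} (bt : Between x z t) (supp : Supporting z t) (unsk : Unskipped x z t) where
      private
        x<t : x < t
        x<t = proj₁ bt

        t<z : t < z
        t<z = proj₂ bt

      -- Here the side `x t` crosses the gap. A common vertex before `t` would be skipped over by
      -- `A`; one after `t` contradicts `supp` if `E` is upper, and `right` at `t` if `E` is lower.
      t-after-gap : k < t → ∀ {A E} → U A → x ∉ A → t ∉ A → (U ∪ L) E → t ∉ E → z ∉ E →
        ∀ v → v ∈ A → v ∈ B → ¬ (v ∈ E)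
      t-after-gap k<t a x∉A t∉A e t∉E z∉E v v∈A v∈B v∈E with <-cmp v t | e
      ... | tri≈ _ refl _ | _ = t∉A v∈A
      ... | tri< v<t _ _ | _ =
        unsk a (left a b x≤k x∉A x∉B v∈A v∈B) v<t v∈A (U-misses-one a x∉A) t∉A
      ... | tri> _ _ t<v | inj₁ e′ = supp e′ t<v (right e′ b k<z z∉E z∉B v∈E v∈B) v∈E t∉E z∉E
      ... | tri> _ _ t<v | inj₂ e′ = ℕ.<-asym t<v (right a e′ k<t t∉A t∉E v∈A v∈E)

      -- The mirror case: the side `t z`, missed by `A`, now crosses the gap.
      t-before-gap : t ≤ᶠ k → ∀ {A E} → U A → t ∉ A → z ∉ A → (U ∪ L) E → x ∉ E → t ∉ E →
        ∀ v → v ∈ A → v ∈ B → ¬ (v ∈ E)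
      t-before-gap t≤k a t∉A z∉A e x∉E t∉E v v∈A v∈B v∈E with <-cmp v t | e
      ... | tri≈ _ refl _ | _ = t∉A v∈A
      ... | tri> _ _ t<v | _ = supp a t<v (right a b k<z z∉A z∉B v∈A v∈B) v∈A t∉A z∉A
      ... | tri< v<t _ _ | inj₁ e′ =
        unsk e′ (left e′ b x≤k x∉E x∉B v∈E v∈B) v<t v∈E (U-misses-one e′ x∉E) t∉E
      ... | tri< v<t _ _ | inj₂ e′ = ℕ.<-asym v<t (left a e′ t≤k t∉A t∉E v∈A v∈E)

      hull-neighbour : ⊥
      hull-neighbour =
        let (E₁ , e₁ , x∉E₁ , t∉E₁) = miss₂ x t (λ { refl → ℕ.n≮n _ x<t })
            (E₂ , e₂ , t∉E₂ , z∉E₂) = miss₂ t z (λ { refl → ℕ.n≮n _ t<z })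
        in cases e₁ x∉E₁ t∉E₁ e₂ t∉E₂ z∉E₂ (ℕ.<-≤-connex (toℕ k) (toℕ t))
        where
        cases : ∀ {E₁ E₂} → (U ∪ L) E₁ → x ∉ E₁ → t ∉ E₁ → (U ∪ L) E₂ → t ∉ E₂ → z ∉ E₂ →
          ¬ (k < t ⊎ t ≤ᶠ k)
        cases (inj₂ e₁) x∉ t∉ _ _ _ (inj₁ k<t) = least t t<z (_ , e₁ , x≤k , k<t , x∉ , t∉)
        cases (inj₁ e₁) x∉ t∉ e₂ t∉′ z∉ (inj₁ k<t) =
          triple (inj₁ e₁) (inj₂ b) e₂ (t-after-gap k<t e₁ x∉ t∉ e₂ t∉′ z∉)
        cases _ _ _ (inj₂ e₂) t∉ z∉ (inj₂ t≤k) = greatest t x<t (_ , e₂ , t≤k , k<z , t∉ , z∉)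
        cases e₁ x∉ t∉ (inj₁ e₂) t∉′ z∉ (inj₂ t≤k) =
          triple (inj₁ e₂) (inj₂ b) e₁ (t-before-gap t≤k e₂ t∉′ z∉ e₁ x∉ t∉)

  adjacentPair-exists : ¬ (∀ x z → BelowPair x z → ¬ (∀ t → ¬ Between x z t))
  adjacentPair-exists none = belowPair-exists λ x₀ z₀ p₀ →
    -- First the least `z` over all `x` is chosen, then the greatest `x` for this `z`.
    noLeast {P = λ z → ∃ λ x → BelowPair x z}
      (λ z (x₁ , p₁) least → noGreatest {P = λ x → BelowPair x z}
        (λ x p greatest → none x z p
          (innermost⇒adjacent p (λ t t<z q → least t t<z (x , q)) greatest))
        x₁ p₁)
      z₀ (x₀ , p₀)

inconsistent : ∀ {n} {U L : Subset n → Set} → HalfplaneSystem U L → Fin n → ⊥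
inconsistent {n} 𝒮 v₀ = gap-exists 𝒮 v₀ λ k g →
  adjacentPair-exists 𝒮 g λ where
    x z (B , b , x≤k , k<z , x∉B , z∉B) adj →
      adjacentPair-exists (dual 𝒮) (dualGap g) λ where
        x′ z′ (A , a , x′≤k , k<z′ , x′∉A , z′∉A) adj′ →
          -- Both pairs enclose the gap with nothing in between, so they coincide.
          let x≡x′ = antisym
                (λ x<x′ → adj x′ (x<x′ , ℕ.≤-<-trans x′≤k k<z))
                (λ x′<x → adj′ x (x′<x , ℕ.≤-<-trans x≤k k<z′))
              z≡z′ = antisym
                (λ z<z′ → adj′ z (ℕ.≤-<-trans x′≤k k<z , z<z′))
                (λ z′<z → adj z′ (ℕ.≤-<-trans x≤k k<z′ , z′<z))
          in not-both-miss 𝒮 g a b x≤k k<z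
               (subst (_∉ A) (sym x≡x′) x′∉A) (subst (_∉ A) (sym z≡z′) z′∉A) x∉B z∉B
  where
  antisym : {x y : Fin n} → ¬ x < y → ¬ y < x → x ≡ y
  antisym {x} {y} x≮y y≮x with <-cmp x y
  ... | tri< x<y _ _ = ⊥-elim (x≮y x<y)
  ... | tri≈ _ x≡y _ = x≡y
  ... | tri> _ _ y<x = ⊥-elim (y≮x y<x)

-- From hypergraphs to systems of complements

CoveredBy : ∀ {n} → (H₁ H₂ H₃ : Subset n) → Set
CoveredBy {n} H₁ H₂ H₃ = ∀ (v : Fin n) → v ∈ H₁ ⊎ v ∈ H₂ ⊎ v ∈ H₃

other : ∀ {n} → 2 ≤ n → (x : Fin n) → ∃ λ y → x ≢ y
other (s≤s (s≤s _)) zero    = suc zero , λ ()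
other (s≤s (s≤s _)) (suc x) = zero , λ ()

module _ {n : ℕ} {ℋ ℱ : Hypergraph n} (free : ABA-free ℱ) where

  Upper : Subset n → Set
  Upper A = A ∈ₗ ℱ × ∁ A ∈ₗ ℋ

  -- Keeping `F` as a witness avoids double complements.
  Lower : Subset n → Set
  Lower B = ∃ λ F → F ∈ₗ ℱ × F ∈ₗ ℋ × B ≡ ∁ F

  complements : 2 ≤ n → (∀ H → H ∈ₗ ℋ → H ∈∪compl ℱ) →
    (∀ x y → x ≢ y → ∃ λ H → H ∈ₗ ℋ × x ∈ H × y ∈ H) →
    (∀ {H₁ H₂ H₃} → H₁ ∈ₗ ℋ → H₂ ∈ₗ ℋ → H₃ ∈ₗ ℋ → ¬ CoveredBy H₁ H₂ H₃) →
    HalfplaneSystem Upper Lower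
  complements 2≤n ℋ⊆ pairs uncovered = record
    { U-free   = λ (A∈ℱ , _) (B∈ℱ , _) → free _ _ A∈ℱ B∈ℱ
    ; L-free   = λ where
        (F , F∈ℱ , _ , refl) (G , G∈ℱ , _ , refl)
          (x , y , z , x<y , y<z , (xF , xG) , (zF , zG) , (yG , yF)) →
          -- Complementation exchanges the two set differences, so `F` and `G` swap roles.
          free G F G∈ℱ F∈ℱ (x , y , z , x<y , y<z ,
            (x∉∁p⇒x∈p xG , x∈∁p⇒x∉p xF) , (x∉∁p⇒x∈p zG , x∈∁p⇒x∉p zF) ,
            (x∉∁p⇒x∈p yF , x∈∁p⇒x∉p yG))
    ; ∩∅∩-free = λ where
        (A∈ℱ , _) (F , F∈ℱ , _ , refl) x<y y<z xA xF yA yF zA zF →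
          free _ F A∈ℱ F∈ℱ (_ , _ , _ , x<y , y<z ,
            (xA , x∈∁p⇒x∉p xF) , (zA , x∈∁p⇒x∉p zF) , (x∉∁p⇒x∈p yF , yA))
    ; ∅∩∅-free = λ where
        (A∈ℱ , _) (F , F∈ℱ , _ , refl) x<y y<z xA xF yA yF zA zF →
          free F _ F∈ℱ A∈ℱ (_ , _ , _ , x<y , y<z ,
            (x∉∁p⇒x∈p xF , xA) , (x∉∁p⇒x∈p zF , zA) , (yA , x∈∁p⇒x∉p yF))
    ; triple   = triple
    -- `pairs` speaks of distinct vertices only, so `2 ≤ n` supplies a second one.
    ; miss₁    = λ x → let (y , x≢y) = other 2≤n x
                           (A , a , x∉A , _) = miss₂ x y x≢y
                       in A , a , x∉A
    ; miss₂    = miss₂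
    }
    where
    hyperedge : ∀ {A} → (Upper ∪ Lower) A → ∃ λ H → H ∈ₗ ℋ × (∀ {v} → v ∉ H → v ∈ A)
    hyperedge {A} (inj₁ (_ , ∁A∈ℋ))     = ∁ A , ∁A∈ℋ , x∉∁p⇒x∈p
    hyperedge (inj₂ (F , _ , F∈ℋ , refl)) = F , F∈ℋ , x∉p⇒x∈∁p

    triple : ∀ {A B C} → (Upper ∪ Lower) A → (Upper ∪ Lower) B → (Upper ∪ Lower) C →
      ¬ (∀ v → v ∈ A → v ∈ B → ¬ (v ∈ C))
    triple a b c disjoint =
      let (H₁ , H₁∈ℋ , ∉H₁) = hyperedge a
          (H₂ , H₂∈ℋ , ∉H₂) = hyperedge b
          (H₃ , H₃∈ℋ , ∉H₃) = hyperedge c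
          covered : CoveredBy H₁ H₂ H₃
          covered v = one-of (v ∈? H₁) (v ∈? H₂) (v ∈? H₃) λ v∉H₁ v∉H₂ v∉H₃ →
            disjoint v (∉H₁ v∉H₁) (∉H₂ v∉H₂) (∉H₃ v∉H₃)
      in uncovered H₁∈ℋ H₂∈ℋ H₃∈ℋ covered
      where
      one-of : {P Q R : Set} → Dec P → Dec Q → Dec R → (¬ P → ¬ Q → ¬ R → ⊥) → P ⊎ Q ⊎ R
      one-of (yes p) _ _ _ = inj₁ p
      one-of (no _) (yes q) _ _ = inj₂ (inj₁ q)
      one-of (no _) (no _) (yes r) _ = inj₂ (inj₂ r)
      one-of (no ¬p) (no ¬q) (no ¬r) h = ⊥-elim (h ¬p ¬q ¬r)

    miss₂ : ∀ x y → x ≢ y → ∃ λ A → (Upper ∪ Lower) A × x ∉ A × y ∉ A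
    miss₂ x y x≢y with pairs x y x≢y
    ... | H , H∈ℋ , x∈H , y∈H with ℋ⊆ H H∈ℋ
    ...   | inj₁ H∈ℱ = ∁ H , inj₂ (H , H∈ℱ , H∈ℋ , refl) , x∈p⇒x∉∁p x∈H , x∈p⇒x∉∁p y∈H
    ...   | inj₂ (F , F∈ℱ , refl) = F , inj₁ (F∈ℱ , H∈ℋ) , x∈∁p⇒x∉p x∈H , x∈∁p⇒x∉p y∈H

mainTheorem6 : (n : ℕ) → 2 ≤ n → (ℋ : Hypergraph n) →
    PseudohalfplaneHypergraph ℋ →
    (∀ (x y : Fin n) → x ≢ y → Σ (Subset n) λ H → H ∈ₗ ℋ × x ∈ H × y ∈ H) →
    Σ (List (Subset n)) λ S → length S ≤ 3 × (∀ H → H ∈ₗ S → H ∈ₗ ℋ) ×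
    (∀ (v : Fin n) → Σ (Subset n) λ H → H ∈ₗ S × v ∈ H)
mainTheorem6 n 2≤n ℋ (ℱ , free , ℋ⊆) pairs
  -- Exhaustive search over triples, repetitions allowed, makes a proof by contradiction sufficient.
  with any? (λ H₁ → any? (λ H₂ → any? (λ H₃ →
         all? λ v → (v ∈? H₁) ⊎-dec ((v ∈? H₂) ⊎-dec (v ∈? H₃))) ℋ) ℋ) ℋ
... | yes found =
  let (H₁ , H₁∈ℋ , found₂) = find found
      (H₂ , H₂∈ℋ , found₃) = find found₂
      (H₃ , H₃∈ℋ , covered) = find found₃
  in H₁ ∷ H₂ ∷ H₃ ∷ [] , s≤s (s≤s (s≤s z≤n)) ,
     (λ where
       _ (here refl)                 → H₁∈ℋ
       _ (there (here refl))         → H₂∈ℋ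
       _ (there (there (here refl))) → H₃∈ℋ) ,
     λ v → select (covered v)
  where
  select : ∀ {H₁ H₂ H₃ : Subset n} {v} → v ∈ H₁ ⊎ v ∈ H₂ ⊎ v ∈ H₃ →
    ∃ λ H → H ∈ₗ (H₁ ∷ H₂ ∷ H₃ ∷ []) × v ∈ H
  select (inj₁ v∈H)        = _ , here refl , v∈H
  select (inj₂ (inj₁ v∈H)) = _ , there (here refl) , v∈H
  select (inj₂ (inj₂ v∈H)) = _ , there (there (here refl)) , v∈H
... | no none = ⊥-elim (inconsistent (complements free 2≤n ℋ⊆ pairs uncovered) (vertex 2≤n))
  where
  uncovered : ∀ {H₁ H₂ H₃} → H₁ ∈ₗ ℋ → H₂ ∈ₗ ℋ → H₃ ∈ₗ ℋ → ¬ CoveredBy H₁ H₂ H₃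
  uncovered H₁∈ℋ H₂∈ℋ H₃∈ℋ covered = none (lose H₁∈ℋ (lose H₂∈ℋ (lose H₃∈ℋ covered)))

  vertex : ∀ {n} → 2 ≤ n → Fin n
  vertex (s≤s _) = zero
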